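{- Let $\Omega\subseteq\Xi$ be closed under variable substitution. (1) If $\Omega$ is transitive, then the relation $\perp^{\Omega}$ satisfies the transitivity axiom: whenever $D\subseteq C\subseteq B$, $B\perp^\Omega_CA$ and $C\perp^\Omega_DA$, then $B\perp^\Omega_DA$. (2) If $\Omega$ is normal, then $\perp^{\Omega}$ satisfies the normality axiom: $A\perp^\Omega_CB$ implies $A\cup C\perp^\Omega_CB$.
   Context: $T$ is a complete consistent first-order theory (possibly many-sorted); we work in a big saturated model of $T$. All sets are small subsets of the big model; $BC$ means $B\cup C$. A tuple also denotes the set of its entries, and $\bar a\in A$ means that all entries of $\bar a$ lie in $A$. Writing a formula as $\varphi(\bar x)$ means that each of its free variables appears in $\bar x$. Inconsistency pairs. For a formula $\varphi(\bar x;\bar y)$ whose free variables are partitioned into two blocks, a formula $\psi(\bar y_0,\dots,\bar y_{k-1})$ (also written $\psi(\bar y_{<k})$; no parameters) is a $k$-inconsistency witness for $\varphi(\bar x;\bar y)$ if $\big(\bigwedge_{i<k}\varphi(\bar x;\bar y_i)\big)\wedge\psi(\bar y_{<k})$ is inconsistent. $\Xi$ is the set of all pairs $(\varphi(\bar x;\bar y),\psi(\bar y_{<k}))$, $k<\omega$, such that $\psi$ is a $k$-inconsistency witness for $\varphi$. Dividing. For $(\varphi,\psi)\in\Xi$, a formula $\varphi(\bar x;\bar b)$ $(\varphi,\psi)$-divides over a set $C$ if there is a sequence $(\bar b_i)_{i<\omega}$ such that each $\bar b_i$ realises $\operatorname{tp}(\bar b/C)$ and $\models\psi(\bar b_{i_0},\dots,\bar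 b_{i_{k-1}})$ for all $i_0<\dots<i_{k-1}<\omega$. A partial type $(\varphi,\psi)$-divides over $C$ if it contains a formula $\varphi(\bar x;\bar b)$ that $(\varphi,\psi)$-divides over $C$. A set $\Omega\subseteq\Xi$ is closed under variable substitution if whenever $(\varphi(\bar x;\bar y),\psi(\bar y_{<k}))\in\Omega$ and $\bar u,\bar v,\bar v_0,\dots,\bar v_{k-1}$ are tuples of variables of appropriate lengths and sorts (possibly with repetitions inside a tuple, but pairwise disjoint from each other), then $(\varphi(\bar u;\bar v),\psi(\bar v_{<k}))\in\Omega$. A partial type $\Omega$-divides over $C$ if it $(\varphi,\psi)$-divides over $C$ for some $(\varphi,\psi)\in\Omega$. Define $A\perp^{\Omega}_CB$ iff there is no $\bar a\in A$ such that $\operatorname{tp}(\bar a/BC)$ $\Omega$-divides over $C$. For $\Omega\subseteq\Xi$ closed under variable substitution: - $\Omega$ is transitive if: whenever $(\varphi(\bar y;\bar x),\psi(\bar x_{<k}))\in\Omega$, $D\subseteq C$, $C\perp^\Omega_D\bar a$ and $\varphi(\bar y;\bar a)$ $(\varphi,\psi)$-divides over $D$, then $\varphi(\bar y;\bar a)$ $(\varphi,\psi)$-divides over $C$. - $\Omega$ is normal if: whenever $(\varphi(\bar x,\bar z;\bar y),\psi(\bar y_{<k}))\in\Omega$, then also $(\varphi(\bar x;\bar z,\bar y),\psi'(\bar y_{<k},\bar z_{<k}))\in\Omega$, where $\psi'(\bar y_{<k},\bar z_{<k})$ is $\psi(\bar y_{<k})\wedge(\bar z_0=\bar z_1=\dots=\bar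 z_{k-1})$. -}

module Defs where

open import Level using (0ℓ)
open import Data.Empty using (⊥)
open import Data.Nat.Base using (ℕ; zero; suc; _<_)
open import Data.Fin.Base using (Fin; inject₁) renaming (suc to fsuc; _<_ to _<ᶠ_)
open import Data.List.Base using (List; []; _∷_; _++_; foldr; tabulate; length)
open import Data.List.Membership.Propositional using () renaming (_∈_ to _∈ˡ_)
open import Data.List.Membership.Propositional.Properties using (∈-lookup)
open import Data.List.Relation.Unary.All using (All; []; _∷_)
open import Data.List.Relation.Unary.Any.Properties using (++⁺ˡ; ++⁺ʳ; ++⁻)
open import Data.Product.Base using (Σ; Σ-syntax; ∃-syntax; _×_; _,_; proj₁)
open import Data.Sum.Base using (_⊎_; inj₁; inj₂; [_,_]′)
open import Function.Base using (_∘_)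
open import Function.Bundles using (_↣_; module Injection)
open import Relation.Binary.PropositionalEquality.Core using (_≡_; refl)
open import Relation.Nullary.Negation.Core using (¬_)
open import Relation.Unary using (Pred; _∈_; _⊆_; _∪_)

------------------------------------------------------------------------
-- Many-sorted syntax

record Language : Set₁ where
  field
    Sort    : Set
    Func    : Set
    Rel     : Set
    dom     : Func → List Sort
    cod     : Func → Sort
    arity   : Rel → List Sort

open Language public

-- A tuple of variables (of arbitrary length, possibly infinite) is given by
-- the family, indexed by sorts, of the sets of its entries.
Family : Language → Set₁
Family L = Sort L → Set

infixr 4 _⟶_
infixr 5 _⊕_

_⟶_ : {S : Set} → (S → Set) → (S → Set) → Set
V ⟶ W = ∀ s → V s → W s

-- Concatenation of two disjoint tuples of variables.
_⊕_ : {S : Set} → (S → Set) → (S → Set) → (S → Set)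
(V ⊕ W) s = V s ⊎ W s

[_∣_] : {S : Set} {V V′ W : S → Set} → (V ⟶ W) → (V′ ⟶ W) → (V ⊕ V′ ⟶ W)
[ f ∣ g ] s (inj₁ v) = f s v
[ f ∣ g ] s (inj₂ v) = g s v

_⊕₁_ : {S : Set} {V V′ W W′ : S → Set} → (V ⟶ W) → (V′ ⟶ W′) → (V ⊕ V′ ⟶ W ⊕ W′)
(f ⊕₁ g) s (inj₁ v) = inj₁ (f s v)
(f ⊕₁ g) s (inj₂ v) = inj₂ (g s v)

none : {S : Set} {W : S → Set} → ((λ _ → ⊥) ⟶ W)
none s ()

single : {S : Set} {W : S → Set} {s : S} → W s → ((s ≡_) ⟶ W)
single w s refl = w

-- A finite tuple of pairwise distinct variables, given by the list of their
-- sorts; the variables are the positions in the list.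
Var : {S : Set} → List S → (S → Set)
Var Γ s = s ∈ˡ Γ

-- Pairwise disjoint copies ȳ₀ , … , ȳₖ₋₁ of a tuple ȳ.
Copies : {S : Set} → ℕ → (S → Set) → (S → Set)
Copies k V s = Fin k × V s

copies : {S : Set} {V W : S → Set} (k : ℕ) → (V ⟶ W) → (Copies k V ⟶ Copies k W)
copies k f s (i , v) = i , f s v

Onto : {S : Set} {V W : S → Set} → (V ⟶ W) → Set
Onto {V = V} {W} f = ∀ s (w : W s) → Σ[ v ∈ V s ] f s v ≡ w

-- The change of variables that regards φ(x̄,z̄;ȳ) as φ(x̄;z̄,ȳ).
shift : {S : Set} (Γ Z Δ : List S) → (Var (Γ ++ Z) ⊕ Var Δ ⟶ Var Γ ⊕ Var (Z ++ Δ))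
shift Γ Z Δ s (inj₁ v) = [ inj₁ , inj₂ ∘ ++⁺ˡ ]′ (++⁻ Γ v)
shift Γ Z Δ s (inj₂ y) = inj₂ (++⁺ʳ Z y)

data Term (L : Language) (V : Family L) : Sort L → Set where
  var : ∀ {s} → V s → Term L V s
  fun : (f : Func L) → All (Term L V) (dom L f) → Term L V (cod L f)

infix  8 _≐_
infixr 7 _∧ᶠ_
infixr 6 _∨ᶠ_
infixr 5 _⇒ᶠ_

-- Formulas whose free variables are among V.  A quantifier over s binds the
-- variable  inj₂ refl  of  V ⊕ (s ≡_).
data Formula (L : Language) (V : Family L) : Set where
  _≐_            : ∀ {s} → Term L V s → Term L V s → Formula L V
  rel            : (r : Rel L) → All (Term L V) (arity L r) → Formula L V
  ⊥ᶠ             : Formula L V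
  _∧ᶠ_ _∨ᶠ_ _⇒ᶠ_ : Formula L V → Formula L V → Formula L V
  ∀ᶠ ∃ᶠ          : (s : Sort L) → Formula L (V ⊕ (s ≡_)) → Formula L V

module _ {L : Language} where

  ⊤ᶠ : {V : Family L} → Formula L V
  ⊤ᶠ = ⊥ᶠ ⇒ᶠ ⊥ᶠ

  ¬ᶠ_ : {V : Family L} → Formula L V → Formula L V
  ¬ᶠ φ = φ ⇒ᶠ ⊥ᶠ

  ⋀ : {V : Family L} {n : ℕ} → (Fin n → Formula L V) → Formula L V
  ⋀ φs = foldr _∧ᶠ_ ⊤ᶠ (tabulate φs)

  mutual
    renameTerm : {V W : Family L} → (V ⟶ W) → ∀ {s} → Term L V s → Term L W s
    renameTerm ρ (var v)    = var (ρ _ v)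
    renameTerm ρ (fun f ts) = fun f (renameTerms ρ ts)

    renameTerms : {V W : Family L} → (V ⟶ W) → ∀ {ss} → All (Term L V) ss → All (Term L W) ss
    renameTerms ρ []       = []
    renameTerms ρ (t ∷ ts) = renameTerm ρ t ∷ renameTerms ρ ts

  -- Simultaneous (capture-avoiding) substitution of variables for variables.
  rename : {V W : Family L} → (V ⟶ W) → Formula L V → Formula L W
  rename ρ (t ≐ u)    = renameTerm ρ t ≐ renameTerm ρ u
  rename ρ (rel r ts) = rel r (renameTerms ρ ts)
  rename ρ ⊥ᶠ         = ⊥ᶠ
  rename ρ (φ ∧ᶠ ψ)   = rename ρ φ ∧ᶠ rename ρ ψ
  rename ρ (φ ∨ᶠ ψ)   = rename ρ φ ∨ᶠ rename ρ ψ
  rename ρ (φ ⇒ᶠ ψ)   = rename ρ φ ⇒ᶠ rename ρ ψ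
  rename ρ (∀ᶠ s φ)   = ∀ᶠ s (rename (ρ ⊕₁ λ _ e → e) φ)
  rename ρ (∃ᶠ s φ)   = ∃ᶠ s (rename (ρ ⊕₁ λ _ e → e) φ)

------------------------------------------------------------------------
-- Structures and theories

record Structure (L : Language) : Set₁ where
  field
    Carrier  : Sort L → Set
    ⟦func⟧   : (f : Func L) → All Carrier (dom L f) → Carrier (cod L f)
    ⟦rel⟧    : (r : Rel L) → All Carrier (arity L r) → Set
    nonempty : (s : Sort L) → Carrier s

open Structure public

module _ {L : Language} (M : Structure L) where

  mutual
    eval : {V : Family L} → (V ⟶ Carrier M) → ∀ {s} → Term L V s → Carrier M s
    eval ρ (var v)    = ρ _ v
    eval ρ (fun f ts) = ⟦func⟧ M f (evals ρ ts)

    evals : {V : Family L} → (V ⟶ Carrier M) → ∀ {ss} → All (Term L V) ss → All (Carrier M) ss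
    evals ρ []       = []
    evals ρ (t ∷ ts) = eval ρ t ∷ evals ρ ts

  infix 3 _⊨_[_]

  _⊨_[_] : {V : Family L} → Formula L V → (V ⟶ Carrier M) → Set
  _⊨_[_] (t ≐ u)    ρ = eval ρ t ≡ eval ρ u
  _⊨_[_] (rel r ts) ρ = ⟦rel⟧ M r (evals ρ ts)
  _⊨_[_] ⊥ᶠ         ρ = ⊥
  _⊨_[_] (φ ∧ᶠ ψ)   ρ = _⊨_[_] φ ρ × _⊨_[_] ψ ρ
  _⊨_[_] (φ ∨ᶠ ψ)   ρ = _⊨_[_] φ ρ ⊎ _⊨_[_] ψ ρ
  _⊨_[_] (φ ⇒ᶠ ψ)   ρ = _⊨_[_] φ ρ → _⊨_[_] ψ ρ
  _⊨_[_] (∀ᶠ s φ)   ρ = (m : Carrier M s) → _⊨_[_] φ [ ρ ∣ single m ]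
  _⊨_[_] (∃ᶠ s φ)   ρ = Σ[ m ∈ Carrier M s ] _⊨_[_] φ [ ρ ∣ single m ]

Sentence : Language → Set
Sentence L = Formula L (λ _ → ⊥)

Theory : Language → Set₁
Theory L = Pred (Sentence L) 0ℓ

module _ {L : Language} where

  _⊨ˢ_ : Structure L → Sentence L → Set
  M ⊨ˢ σ = M ⊨ σ [ none ]

  IsModel : Theory L → Structure L → Set
  IsModel T M = ∀ σ → σ ∈ T → M ⊨ˢ σ

  _⊩_ : Theory L → Sentence L → Set₁
  T ⊩ σ = ∀ M → IsModel T M → M ⊨ˢ σ

  Consistent : Theory L → Set₁
  Consistent T = Σ[ M ∈ Structure L ] IsModel T M

  Complete : Theory L → Set₁
  Complete T = ∀ σ → T ⊩ σ ⊎ T ⊩ (¬ᶠ σ)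

  -- A formula is inconsistent (modulo T) if it is realised in no model of T.
  Inconsistent : Theory L → {V : Family L} → Formula L V → Set₁
  Inconsistent T {V} φ =
    ∀ M → IsModel T M → (ρ : V ⟶ Carrier M) → ¬ (M ⊨ φ [ ρ ])

------------------------------------------------------------------------
-- Parameter sets and partial types

module _ {L : Language} (M : Structure L) where

  Element : Set
  Element = Σ (Sort L) (Carrier M)

  SetOfElements : Set₁
  SetOfElements = Pred Element 0ℓ

  ⟨_⟩ : SetOfElements → Family L
  ⟨ A ⟩ s = Σ[ m ∈ Carrier M s ] (s , m) ∈ A

  -- L(A)-formulas in the variables X: the constants for the elements of A are
  -- represented by further variables, which are always evaluated at the
  -- element they stand for.
  Formulaᴾ : SetOfElements → Family L → Set
  Formulaᴾ A X = Formula L (X ⊕ ⟨ A ⟩)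

  Satisfies : (A : SetOfElements) {X : Family L} → (X ⟶ Carrier M) → Formulaᴾ A X → Set
  Satisfies A a χ = M ⊨ χ [ [ a ∣ (λ _ → proj₁) ] ]

  PartialType : SetOfElements → Family L → Set₁
  PartialType A X = Pred (Formulaᴾ A X) 0ℓ

  Realises : {A : SetOfElements} {X : Family L} → (X ⟶ Carrier M) → PartialType A X → Set
  Realises {A} a p = ∀ χ → χ ∈ p → Satisfies A a χ

  tp : {X : Family L} → (X ⟶ Carrier M) → (A : SetOfElements) → PartialType A X
  tp a A χ = Satisfies A a χ

  FinitelySatisfiable : {A : SetOfElements} {X : Family L} → PartialType A X → Set
  FinitelySatisfiable {A} {X} p =
    ∀ (χs : List (Formulaᴾ A X)) → All p χs →
    Σ[ a ∈ (X ⟶ Carrier M) ] All (Satisfies A a) χs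

  entries : {X : Family L} → (X ⟶ Carrier M) → SetOfElements
  entries {X} a (s , m) = Σ[ x ∈ X s ] a s x ≡ m

  _⊆ᵗ_ : {X : Family L} → (X ⟶ Carrier M) → SetOfElements → Set
  a ⊆ᵗ A = entries a ⊆ A

-- |A| < |K|, that is, K does not inject into A.
Small : {L : Language} (M : Structure L) → Set → SetOfElements M → Set
Small M K A = ¬ (Σ[ f ∈ K ↣ Element M ] (∀ k → Injection.to f k ∈ A))

-- A big saturated model of T.  The cardinal κ = |K| equals |M| when M is
-- infinite, by saturation and boundedness.  It is kept separate from |M| so
-- that all subsets of a finite M are small.  The field  big  says |L| + ℵ₀ < κ.
record BigSaturatedModel {L : Language} (T : Theory L) : Set₁ where
  field
    𝕄         : Structure L
    isModel   : IsModel T 𝕄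
    K         : Set
    big       : ¬ (K ↣ ((Sort L ⊎ Func L ⊎ Rel L) ⊎ ℕ))
    bounded   : Element 𝕄 ↣ K
    saturated : (A : SetOfElements 𝕄) → Small 𝕄 K A →
                (s : Sort L) (p : PartialType 𝕄 A (s ≡_)) →
                FinitelySatisfiable 𝕄 p →
                Σ[ a ∈ ((s ≡_) ⟶ Carrier 𝕄) ] Realises 𝕄 a p

------------------------------------------------------------------------
-- Inconsistency pairs

-- ( φ(x̄;ȳ) , ψ(ȳ₀,…,ȳₖ₋₁) )  with x̄ = Var Γ and ȳ = Var Δ.
record Pair (L : Language) : Set where
  constructor pair
  field
    {xs ys} : List (Sort L)
    {k}     : ℕ
    φ       : Formula L (Var xs ⊕ Var ys)
    ψ       : Formula L (Copies k (Var ys))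

module _ {L : Language} where

  IsInconsistencyWitness : Theory L → {Γ Δ : List (Sort L)} (k : ℕ) →
    Formula L (Var Γ ⊕ Var Δ) → Formula L (Copies k (Var Δ)) → Set₁
  IsInconsistencyWitness T {Γ} {Δ} k φ ψ =
    Inconsistent T {Var Γ ⊕ Copies k (Var Δ)}
      (⋀ (λ i → rename ((λ _ x → x) ⊕₁ (λ _ y → i , y)) φ) ∧ᶠ rename (λ _ → inj₂) ψ)

  Ξ : Theory L → Pred (Pair L) _
  Ξ T (pair φ ψ) = IsInconsistencyWitness T _ φ ψ

  -- The tuples ū and v̄ consist of variables of Γ′ and Δ′ (every one of which
  -- occurs), and v̄ᵢ is the copy of v̄ in the i-th copy of Δ′.
  ClosedUnderSubstitution : ∀ {ℓ} → Pred (Pair L) ℓ → Set ℓ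
  ClosedUnderSubstitution Ω =
    ∀ {Γ Δ k} (φ : Formula L (Var Γ ⊕ Var Δ)) (ψ : Formula L (Copies k (Var Δ))) →
    pair φ ψ ∈ Ω →
    ∀ {Γ′ Δ′} (u : Var Γ ⟶ Var Γ′) (v : Var Δ ⟶ Var Δ′) → Onto u → Onto v →
    pair (rename (u ⊕₁ v) φ) (rename (copies k v) ψ) ∈ Ω

  _≐ᵗ_ : {Γ : List (Sort L)} {V : Family L} → (Var Γ ⟶ V) → (Var Γ ⟶ V) → Formula L V
  _≐ᵗ_ {Γ} z w = ⋀ {n = length Γ} (λ j → var (z _ (∈-lookup j)) ≐ var (w _ (∈-lookup j)))

  -- z̄₀ = z̄₁ = … = z̄ₖ₋₁
  allEqual : (k : ℕ) {Z : List (Sort L)} → Formula L (Copies k (Var Z))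
  allEqual zero    = ⊤ᶠ
  allEqual (suc n) = ⋀ {n = n} (λ i → (λ _ v → inject₁ i , v) ≐ᵗ (λ _ v → fsuc i , v))

  Normal : ∀ {ℓ} → Pred (Pair L) ℓ → Set ℓ
  Normal Ω =
    ∀ {Γ Z Δ k} (φ : Formula L (Var (Γ ++ Z) ⊕ Var Δ)) (ψ : Formula L (Copies k (Var Δ))) →
    pair φ ψ ∈ Ω →
    pair {xs = Γ} {ys = Z ++ Δ}
      (rename (shift Γ Z Δ) φ)
      (rename (copies k (λ _ → ++⁺ʳ Z)) ψ ∧ᶠ rename (copies k (λ _ → ++⁺ˡ {xs = Z})) (allEqual k)) ∈ Ω

------------------------------------------------------------------------
-- Dividing and independence

module _ {L : Language} (M : Structure L) where

  -- φ(x̄;b̄) (φ,ψ)-divides over C.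
  record FormulaDivides (π : Pair L) (b : Var (Pair.ys π) ⟶ Carrier M)
                        (C : SetOfElements M) : Set where
    open Pair π
    field
      seq      : ℕ → (Var ys ⟶ Carrier M)
      realises : ∀ i → Realises M (seq i) (tp M b C)
      witness  : (ι : Fin k → ℕ) → (∀ {p q} → p <ᶠ q → ι p < ι q) →
                 M ⊨ ψ [ (λ s (p , y) → seq (ι p) s y) ]

  -- The partial type p, over B and in the variables X, (φ,ψ)-divides over C.
  -- The variables of φ are displayed as entries u of X.
  record TypeDivides (π : Pair L) {B : SetOfElements M} {X : Family L}
                     (p : PartialType M B X) (C : SetOfElements M) : Set where
    open Pair π
    field
      u        : Var xs ⟶ X
      b        : Var ys ⟶ ⟨_⟩ M B
      contains : rename (u ⊕₁ b) φ ∈ p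
      divides  : FormulaDivides π (λ s y → proj₁ (b s y)) C

  Divides : ∀ {ℓ} → Pred (Pair L) ℓ → {B : SetOfElements M} {X : Family L} →
            PartialType M B X → SetOfElements M → Set ℓ
  Divides Ω p C = ∃[ π ] π ∈ Ω × TypeDivides π p C

  -- A ⊥^Ω_C B
  Indep : ∀ {ℓ} → Pred (Pair L) ℓ → (A C B : SetOfElements M) → Set _
  Indep Ω A C B =
    ¬ (Σ[ X ∈ Family L ] Σ[ a ∈ (X ⟶ Carrier M) ]
         _⊆ᵗ_ M a A × Divides Ω (tp M a (B ∪ C)) C)

module _ {L : Language} {T : Theory L} (𝓜 : BigSaturatedModel T) where
  open BigSaturatedModel 𝓜

  Transitive : ∀ {ℓ} → Pred (Pair L) ℓ → Set _
  Transitive Ω =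
    ∀ {Γ Δ k} (φ : Formula L (Var Γ ⊕ Var Δ)) (ψ : Formula L (Copies k (Var Δ))) →
    pair φ ψ ∈ Ω →
    ∀ (C D : SetOfElements 𝕄) → Small 𝕄 K C → Small 𝕄 K D → D ⊆ C →
    (a : Var Δ ⟶ Carrier 𝕄) →
    Indep 𝕄 Ω C D (entries 𝕄 a) →
    FormulaDivides 𝕄 (pair φ ψ) a D → FormulaDivides 𝕄 (pair φ ψ) a C

-- Part (1): the set of parameters of a dividing formula φ(x̄;b̄) lies in A ∪ D,
-- so transitivity of Ω applies to b̄ by monotonicity of C ⊥_D A in A, and
-- φ(x̄;b̄) then witnesses that B ⊥_C A fails.
--
-- Part (2): split the variables of φ(x̄;b̄) into those evaluated in A and those
-- evaluated at a tuple c̄ of C.  Normality moves c̄ to the parameters; dividing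
-- over C is witnessed by the sequence c̄b̄ᵢ, because c̄ is fixed over C.
module Submission where

open import Data.Nat.Base using (ℕ; zero; suc)
open import Data.Fin.Base using (Fin) renaming (zero to fzero; suc to fsuc)
open import Data.List.Base using (List; []; _∷_; _++_; length)
open import Data.List.Relation.Unary.All using (All; []; _∷_)
open import Data.List.Relation.Unary.Any using (here; there)
open import Data.List.Relation.Unary.Any.Properties
  using (++⁺ˡ; ++⁺ʳ; ++⁻; ++⁺∘++⁻; ++⁻∘++⁺)
open import Data.Product.Base using (_×_; _,_; proj₁; proj₂; map₂)
open import Data.Sum.Base as Sum using (inj₁; inj₂; map₁; [_,_]′)
open import Function.Base using (id; _∘_; _$_)
open import Function.Bundles using (_⇔_; mk⇔; module Equivalence)
open import Relation.Binary.PropositionalEquality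
  using (_≡_; refl; sym; trans; cong; cong₂; subst)
open import Relation.Unary using (Pred; _∈_; _⊆_; _∪_)
open import Defs

open Equivalence using (to; from)

private variable
  L : Language

-- Maps between tuples of variables

idᶠ : {S : Set} {V : S → Set} → (V ⟶ V)
idᶠ _ v = v

infixr 9 _∘ᶠ_
infix  4 _≗ᶠ_

_∘ᶠ_ : {S : Set} {U V W : S → Set} → (V ⟶ W) → (U ⟶ V) → (U ⟶ W)
(g ∘ᶠ f) s = g s ∘ f s

_≗ᶠ_ : {S : Set} {V W : S → Set} → (V ⟶ W) → (V ⟶ W) → Set
f ≗ᶠ g = ∀ s v → f s v ≡ g s v

-- Satisfaction

module _ (M : Structure L) where

  mutual
    eval-rename : {V W : Family L} (f : V ⟶ W) {ρ : W ⟶ Carrier M} {σ : V ⟶ Carrier M} →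
      ρ ∘ᶠ f ≗ᶠ σ →
      ∀ {s} (t : Term L V s) → eval M ρ (renameTerm f t) ≡ eval M σ t
    eval-rename f ρf≗σ (var v)    = ρf≗σ _ v
    eval-rename f ρf≗σ (fun g ts) = cong (⟦func⟧ M g) (evals-rename f ρf≗σ ts)

    evals-rename : {V W : Family L} (f : V ⟶ W) {ρ : W ⟶ Carrier M} {σ : V ⟶ Carrier M} →
      ρ ∘ᶠ f ≗ᶠ σ →
      ∀ {ss} (ts : All (Term L V) ss) → evals M ρ (renameTerms f ts) ≡ evals M σ ts
    evals-rename f ρf≗σ []       = refl
    evals-rename f ρf≗σ (t ∷ ts) = cong₂ _∷_ (eval-rename f ρf≗σ t) (evals-rename f ρf≗σ ts)

  ≗-bind : {V W : Family L} (f : V ⟶ W) {ρ : W ⟶ Carrier M} {σ : V ⟶ Carrier M} →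
    ρ ∘ᶠ f ≗ᶠ σ → ∀ {s₀} (m : Carrier M s₀) →
    [ ρ ∣ single m ] ∘ᶠ (f ⊕₁ idᶠ) ≗ᶠ [ σ ∣ single m ]
  ≗-bind f ρf≗σ m s (inj₁ v) = ρf≗σ s v
  ≗-bind f ρf≗σ m s (inj₂ e) = refl

  -- The substitution lemma, by induction on the formula. The valuations are compared pointwise so
  -- that `≗-bind` can carry the comparison under a quantifier by cases on the variable; implication
  -- needs both directions at once.
  ⊨-rename : {V W : Family L} (f : V ⟶ W) {ρ : W ⟶ Carrier M} {σ : V ⟶ Carrier M} →
    ρ ∘ᶠ f ≗ᶠ σ →
    (φ : Formula L V) → (M ⊨ rename f φ [ ρ ]) ⇔ (M ⊨ φ [ σ ])
  ⊨-rename f ρf≗σ (t ≐ u) = mk⇔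
    (λ p → trans (sym (eval-rename f ρf≗σ t)) (trans p (eval-rename f ρf≗σ u)))
    (λ p → trans (eval-rename f ρf≗σ t) (trans p (sym (eval-rename f ρf≗σ u))))
  ⊨-rename f ρf≗σ (rel r ts) = mk⇔
    (subst (⟦rel⟧ M r) (evals-rename f ρf≗σ ts))
    (subst (⟦rel⟧ M r) (sym (evals-rename f ρf≗σ ts)))
  ⊨-rename f ρf≗σ ⊥ᶠ = mk⇔ id id
  ⊨-rename f ρf≗σ (φ ∧ᶠ ψ) = mk⇔
    (λ (p , q) → to (⊨-rename f ρf≗σ φ) p , to (⊨-rename f ρf≗σ ψ) q)
    (λ (p , q) → from (⊨-rename f ρf≗σ φ) p , from (⊨-rename f ρf≗σ ψ) q)
  ⊨-rename f ρf≗σ (φ ∨ᶠ ψ) = mk⇔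
    [ inj₁ ∘ to (⊨-rename f ρf≗σ φ) , inj₂ ∘ to (⊨-rename f ρf≗σ ψ) ]′
    [ inj₁ ∘ from (⊨-rename f ρf≗σ φ) , inj₂ ∘ from (⊨-rename f ρf≗σ ψ) ]′
  ⊨-rename f ρf≗σ (φ ⇒ᶠ ψ) = mk⇔
    (λ h → to (⊨-rename f ρf≗σ ψ) ∘ h ∘ from (⊨-rename f ρf≗σ φ))
    (λ h → from (⊨-rename f ρf≗σ ψ) ∘ h ∘ to (⊨-rename f ρf≗σ φ))
  ⊨-rename f ρf≗σ (∀ᶠ s φ) = mk⇔
    (λ h m → to (⊨-rename (f ⊕₁ idᶠ) (≗-bind f ρf≗σ m) φ) (h m))
    (λ h m → from (⊨-rename (f ⊕₁ idᶠ) (≗-bind f ρf≗σ m) φ) (h m))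
  ⊨-rename f ρf≗σ (∃ᶠ s φ) = mk⇔
    (λ (m , h) → m , to (⊨-rename (f ⊕₁ idᶠ) (≗-bind f ρf≗σ m) φ) h)
    (λ (m , h) → m , from (⊨-rename (f ⊕₁ idᶠ) (≗-bind f ρf≗σ m) φ) h)

  ⊨-⋀ : {V : Family L} {ρ : V ⟶ Carrier M} (n : ℕ) {φs : Fin n → Formula L V} →
    (∀ i → M ⊨ φs i [ ρ ]) → M ⊨ ⋀ φs [ ρ ]
  ⊨-⋀ zero    h = id
  ⊨-⋀ (suc n) h = h fzero , ⊨-⋀ n (h ∘ fsuc)

  ⊨-allEqual : ∀ k {Z} (c : Var Z ⟶ Carrier M) →
    M ⊨ allEqual k [ (λ s (_ , z) → c s z) ]
  ⊨-allEqual zero        c = id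
  ⊨-allEqual (suc k) {Z} c = ⊨-⋀ k λ i → ⊨-⋀ (length Z) λ j → refl

-- Finite tuples

append : {S : Set} {W : S → Set} {Z Δ : List S} →
  (Var Z ⟶ W) → (Var Δ ⟶ W) → (Var (Z ++ Δ) ⟶ W)
append {Z = Z} f g s x = [ f ∣ g ] s (++⁻ Z x)

module _ {S : Set} {W : S → Set} {Z Δ : List S} (f : Var Z ⟶ W) (g : Var Δ ⟶ W) where

  append-++⁺ˡ : ∀ s z → append f g s (++⁺ˡ z) ≡ f s z
  append-++⁺ˡ s z = cong ([ f ∣ g ] s) (++⁻∘++⁺ Z (inj₁ z))

  append-++⁺ʳ : ∀ s y → append f g s (++⁺ʳ Z y) ≡ g s y
  append-++⁺ʳ s y = cong ([ f ∣ g ] s) (++⁻∘++⁺ Z (inj₂ y))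

-- Sorts the entries of a finite tuple into those coming from `F` and those coming from `G`.
-- Surjectivity of `part` is recorded because closure under substitution admits only renamings in
-- which every new variable occurs.
record Splitting {S : Set} {F G : S → Set} {xs : List S} (e : Var xs ⟶ F ⊕ G) : Set where
  field
    {ls rs} : List S
    left    : Var ls ⟶ F
    right   : Var rs ⟶ G
    part    : Var xs ⟶ Var ls ⊕ Var rs
    onto    : Onto part
    factors : (left ⊕₁ right) ∘ᶠ part ≗ᶠ e

  -- The substitution that reorders the variables into one concatenated block, the shape to which
  -- normality applies.
  merge : Var xs ⟶ Var (ls ++ rs)
  merge s x = [ ++⁺ˡ , ++⁺ʳ ls ]′ (part s x)

  merge-onto : Onto merge
  merge-onto s w with onto s (++⁻ ls w)
  ... | x , eq = x , trans (cong [ ++⁺ˡ , ++⁺ʳ ls ]′ eq) (++⁺∘++⁻ ls w)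

  ++⁻-merge : ∀ s x → ++⁻ ls (merge s x) ≡ part s x
  ++⁻-merge s x = ++⁻∘++⁺ ls (part s x)

cons : {S : Set} {V : S → Set} {t : S} {xs : List S} → V t → (Var xs ⟶ V) → (Var (t ∷ xs) ⟶ V)
cons v f s (here refl) = v
cons v f s (there x)   = f s x

split : {S : Set} {F G : S → Set} {xs : List S} (e : Var xs ⟶ F ⊕ G) → Splitting e
split {xs = []} e = record
  { ls = [] ; rs = [] ; left = λ _ () ; right = λ _ () ; part = λ _ ()
  ; onto = λ { _ (inj₁ ()) ; _ (inj₂ ()) } ; factors = λ _ () }
-- Induction on the tuple: the head joins the side on which its value lies, and `eq` keeps that
-- value for `factors`.
split {xs = t ∷ xs} e with e t (here refl) in eq | split {xs = xs} (λ s x → e s (there x))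
... | inj₁ a | S = record
  { left    = cons a left
  ; right   = right
  ; part    = cons (inj₁ (here refl)) (λ s → map₁ there ∘ part s)
  ; onto    = λ where
      s (inj₁ (here refl)) → here refl , refl
      s (inj₁ (there l))   → let x , p = onto s (inj₁ l) in there x , cong (map₁ there) p
      s (inj₂ r)           → let x , p = onto s (inj₂ r) in there x , cong (map₁ there) p
  ; factors = λ where
      s (here refl) → sym eq
      s (there x)   → trans (shiftˡ s (part s x)) (factors s x)
  }
  where
  open Splitting S
  shiftˡ : ∀ s y → (cons a left ⊕₁ right) s (map₁ there y) ≡ (left ⊕₁ right) s y
  shiftˡ s (inj₁ _) = refl
  shiftˡ s (inj₂ _) = refl
... | inj₂ c | S = record
  { left    = left
  ; right   = cons c right
  ; part    = cons (inj₂ (here refl)) (λ s → Sum.map₂ there ∘ part s)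
  ; onto    = λ where
      s (inj₂ (here refl)) → here refl , refl
      s (inj₂ (there r))   → let x , p = onto s (inj₂ r) in there x , cong (Sum.map₂ there) p
      s (inj₁ l)           → let x , p = onto s (inj₁ l) in there x , cong (Sum.map₂ there) p
  ; factors = λ where
      s (here refl) → sym eq
      s (there x)   → trans (shiftʳ s (part s x)) (factors s x)
  }
  where
  open Splitting S
  shiftʳ : ∀ s y → (left ⊕₁ cons c right) s (Sum.map₂ there y) ≡ (left ⊕₁ right) s y
  shiftʳ s (inj₁ _) = refl
  shiftʳ s (inj₂ _) = refl

-- Dividing and independence

module _ (M : Structure L) where

  -- Only the formulas φ(x̄;b̄) matter for Ω-dividing, so a larger or smaller
  -- parameter set may be used as long as it contains b̄.
  typeDivides-params : {π : Pair L} {B B′ C : SetOfElements M} {X : Family L}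
    {a : X ⟶ Carrier M} (d : TypeDivides M π (tp M a B) C) {C′ : SetOfElements M} →
    (∀ s y → (s , proj₁ (TypeDivides.b d s y)) ∈ B′) →
    FormulaDivides M π (λ s y → proj₁ (TypeDivides.b d s y)) C′ →
    TypeDivides M π (tp M a B′) C′
  typeDivides-params {π = π} {a = a} d b∈B′ div = record
    { u        = u
    ; b        = λ s y → proj₁ (b s y) , b∈B′ s y
    -- Both renamed formulas reduce to `φ` under the same valuation, since evaluation forgets the
    -- membership proofs.
    ; contains = from (⊨-rename M _ agree (Pair.φ π))
                   (to (⊨-rename M _ (λ _ _ → refl) (Pair.φ π)) contains)
    ; divides  = div
    }
    where
    open TypeDivides d
    agree : ∀ s v → _ ≡ _
    agree s (inj₁ x) = refl
    agree s (inj₂ y) = refl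

  -- The inclusion may use `C` as well, since independence from `B` over `C` concerns types over
  -- `B ∪ C`.
  indep-monoʳ : ∀ {ℓ} {Ω : Pred (Pair L) ℓ} {A C B B′ : SetOfElements M} →
    B′ ⊆ B ∪ C → Indep M Ω A C B → Indep M Ω A C B′
  indep-monoʳ B′⊆B∪C A⊥B (X , a , a∈A , π , π∈Ω , d) =
    A⊥B (X , a , a∈A , π , π∈Ω ,
      typeDivides-params d (λ s y → [ B′⊆B∪C , inj₂ ]′ (proj₂ (b s y))) divides)
    where open TypeDivides d

  -- The same sequence serves, because dividing is a condition on `ψ`, the type of `b` over `C` and
  -- the sequence; this lets `φ` be exchanged for a renamed form.
  formulaDivides-weaken : {Γ Γ′ Δ : List (Sort L)} {k : ℕ}
    {φ : Formula L (Var Γ ⊕ Var Δ)} {ψ ψ′ : Formula L (Copies k (Var Δ))}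
    (φ′ : Formula L (Var Γ′ ⊕ Var Δ)) {b : Var Δ ⟶ Carrier M} {C : SetOfElements M} →
    (∀ ρ → M ⊨ ψ [ ρ ] → M ⊨ ψ′ [ ρ ]) →
    FormulaDivides M (pair φ ψ) b C → FormulaDivides M (pair φ′ ψ′) b C
  formulaDivides-weaken φ′ ψ⇒ψ′ div = record
    { seq      = seq
    ; realises = realises
    ; witness  = λ ι ι-mono → ψ⇒ψ′ _ (witness ι ι-mono)
    }
    where open FormulaDivides div

  -- Agreement of `cb` with the concatenation is pointwise so as to cover the projection of a
  -- concatenation whose entries carry membership proofs.
  ++-formulaDivides : {Γ Z Γ′ Δ : List (Sort L)} {k : ℕ}
    {φ : Formula L (Var Γ ⊕ Var Δ)} {ψ : Formula L (Copies k (Var Δ))}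
    (φ′ : Formula L (Var Γ′ ⊕ Var (Z ++ Δ))) {b : Var Δ ⟶ Carrier M} {C : SetOfElements M}
    (c : Var Z ⟶ ⟨_⟩ M C) {cb : Var (Z ++ Δ) ⟶ Carrier M} →
    append (λ s z → proj₁ (c s z)) b ≗ᶠ cb →
    FormulaDivides M (pair φ ψ) b C →
    FormulaDivides M
      (pair φ′ (rename (copies k (λ _ → ++⁺ʳ Z)) ψ ∧ᶠ
                rename (copies k (λ _ → ++⁺ˡ {xs = Z})) (allEqual k)))
      cb C
  ++-formulaDivides {Z = Z} {Δ = Δ} {k = k} {ψ = ψ} φ′ {b} {C} c {cb} b≗cb div = record
    { seq      = λ i → append c₀ (seq i)
    -- A formula true of the extended tuple becomes, through `fix`, a formula over `C` true of `b`;
    -- it passes to `seq i` and is read back.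
    ; realises = λ i χ →
        to (⊨-rename M fix (agree (seq i)) χ) ∘
        realises i (rename fix χ) ∘
        from (⊨-rename M fix agree-b χ)
    ; witness  = λ ι ι-mono →
        from (⊨-rename M _ (λ s (p , y) → append-++⁺ʳ c₀ (seq (ι p)) s y) ψ) (witness ι ι-mono) ,
        from (⊨-rename M _ (λ s (p , z) → append-++⁺ˡ c₀ (seq (ι p)) s z) (allEqual k))
          (⊨-allEqual M k c₀)
    }
    where
    open FormulaDivides div
    c₀ : Var Z ⟶ Carrier M
    c₀ s z = proj₁ (c s z)
    -- Reads χ(z̄,ȳ) over C as the formula χ(c̄,ȳ) over C.
    fix : Var (Z ++ Δ) ⊕ ⟨_⟩ M C ⟶ Var Δ ⊕ ⟨_⟩ M C
    fix = [ append (λ s → inj₂ ∘ c s) (λ _ → inj₁) ∣ (λ _ → inj₂) ]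
    agree : ∀ (b′ : Var Δ ⟶ Carrier M) →
      [ b′ ∣ (λ _ → proj₁) ] ∘ᶠ fix ≗ᶠ [ append c₀ b′ ∣ (λ _ → proj₁) ]
    agree b′ s (inj₁ w) with ++⁻ Z w
    ... | inj₁ z = refl
    ... | inj₂ y = refl
    agree b′ s (inj₂ e) = refl
    agree-b : [ b ∣ (λ _ → proj₁) ] ∘ᶠ fix ≗ᶠ [ cb ∣ (λ _ → proj₁) ]
    agree-b s (inj₁ w) = trans (agree b s (inj₁ w)) (b≗cb s w)
    agree-b s (inj₂ e) = refl

-- Transitivity

module _ {T : Theory L} (𝓜 : BigSaturatedModel T) where
  open BigSaturatedModel 𝓜

  indep-transitive : ∀ {ℓ} {Ω : Pred (Pair L) ℓ} → Transitive 𝓜 Ω →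
    {A B C D : SetOfElements 𝕄} → Small 𝕄 K C → Small 𝕄 K D → D ⊆ C →
    Indep 𝕄 Ω B C A → Indep 𝕄 Ω C D A → Indep 𝕄 Ω B D A
  indep-transitive {Ω = Ω} Ω-trans {A} {B} {C} {D} C-small D-small D⊆C B⊥A C⊥A
    (X , a , a∈B , π@(pair φ ψ) , π∈Ω , d) =
    B⊥A (X , a , a∈B , π , π∈Ω , typeDivides-params 𝕄 d
      -- The parameters lie in `A ∪ D`, hence in `A ∪ C`, over which the type must divide to
      -- contradict `B⊥A`.
      (λ s y → [ inj₁ , inj₂ ∘ D⊆C ]′ (proj₂ (b s y)))
      (Ω-trans φ ψ π∈Ω C D C-small D-small D⊆C _
        (indep-monoʳ 𝕄 {Ω = Ω} {B = A} b∈A∪D C⊥A) divides))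
    where
    open TypeDivides d
    b∈A∪D : entries 𝕄 (λ s y → proj₁ (b s y)) ⊆ A ∪ D
    b∈A∪D (y , refl) = proj₂ (b _ y)

-- Normality

module _ (M : Structure L) where

  indep-normal : ∀ {ℓ} {Ω : Pred (Pair L) ℓ} → ClosedUnderSubstitution Ω → Normal Ω →
    {A B C : SetOfElements M} → Indep M Ω A C B → Indep M Ω (A ∪ C) C B
  indep-normal Ω-closed Ω-normal {A} {B} {C} A⊥B
    (X , a , a∈A∪C , pair {xs} {ys} {k} φ ψ , π∈Ω , d) =
    A⊥B (Var ls , a′ , (λ { (l , refl) → proj₂ (left _ l) }) , _ ,
      Ω-normal {Γ = ls} {Z = rs} _ _ (Ω-closed φ ψ π∈Ω merge idᶠ merge-onto (λ _ y → y , refl)) ,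
      record
        { u        = idᶠ
        ; b        = b′
        -- The three renamings are peeled off from the outside in; `agree` then matches the
        -- resulting valuation of `φ` with the one in the original type.
        ; contains =
            from (⊨-rename M _ (λ _ _ → refl) (rename (shift ls rs ys) φ₁)) $
            from (⊨-rename M (shift ls rs ys) (λ _ _ → refl) φ₁) $
            from (⊨-rename M (merge ⊕₁ idᶠ) agree φ) $
            to (⊨-rename M _ (λ _ _ → refl) φ) contains
        ; divides  =
            -- Closure under substitution has renamed `ψ` along the identity, which is not
            -- definitionally `ψ`; the weakening step absorbs this.
            ++-formulaDivides M _ right b′-values
              (formulaDivides-weaken M φ₁ (λ _ → from (⊨-rename M _ (λ _ _ → refl) ψ)) divides)
        })
    where
    open TypeDivides d
    -- Each displayed entry is tagged with the side, `A` or `C`, given by its membership proof; an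
    -- element of both goes where that proof puts it.
    e : Var xs ⟶ ⟨_⟩ M A ⊕ ⟨_⟩ M C
    e s x = [ (λ p → inj₁ (a s (u s x) , p)) , (λ p → inj₂ (a s (u s x) , p)) ]′
              (a∈A∪C (u s x , refl))
    open Splitting (split e)
    a′ : Var ls ⟶ Carrier M
    a′ s l = proj₁ (left s l)
    c : Var rs ⟶ ⟨_⟩ M (B ∪ C)
    c s r = map₂ inj₂ (right s r)
    b′ : Var (rs ++ ys) ⟶ ⟨_⟩ M (B ∪ C)
    b′ = append c b
    φ₁ : Formula L (Var (ls ++ rs) ⊕ Var ys)
    φ₁ = rename (merge ⊕₁ idᶠ) φ
    value : ⟨_⟩ M A ⊕ ⟨_⟩ M C ⟶ Carrier M
    value = [ (λ _ → proj₁) ∣ (λ _ → proj₁) ]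
    values : Var ls ⊕ Var (rs ++ ys) ⟶ Carrier M
    values = [ a′ ∣ (λ _ → proj₁) ] ∘ᶠ (idᶠ ⊕₁ b′)
    b′-values : append (λ s r → proj₁ (right s r)) (λ s y → proj₁ (b s y)) ≗ᶠ
                (λ s w → proj₁ (b′ s w))
    b′-values s w with ++⁻ rs w
    ... | inj₁ r = refl
    ... | inj₂ y = refl
    value-e : value ∘ᶠ e ≗ᶠ a ∘ᶠ u
    value-e s x with a∈A∪C (u s x , refl)
    ... | inj₁ _ = refl
    ... | inj₂ _ = refl
    values-part : (λ s y → values s ([ inj₁ , inj₂ ∘ ++⁺ˡ ]′ y)) ≗ᶠ value ∘ᶠ (left ⊕₁ right)
    values-part s (inj₁ l) = refl
    values-part s (inj₂ r) = cong proj₁ (append-++⁺ˡ c b s r)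
    agree : values ∘ᶠ shift ls rs ys ∘ᶠ (merge ⊕₁ idᶠ) ≗ᶠ
            [ a ∣ (λ _ → proj₁) ] ∘ᶠ (u ⊕₁ b)
    -- `shift` splits the merged position again, which recovers `part s x`.
    agree s (inj₁ x) rewrite ++⁻-merge s x =
      trans (values-part s (part s x)) (trans (cong (value s) (factors s x)) (value-e s x))
    agree s (inj₂ y) = cong proj₁ (append-++⁺ʳ c b s y)

proposition2p16 : ∀ {ℓ} (L : Language) (T : Theory L) → Consistent T → Complete T →
    (𝓜 : BigSaturatedModel T) →
    let open BigSaturatedModel 𝓜 in
    (Ω : Pred (Pair L) ℓ) → Ω ⊆ Ξ T → ClosedUnderSubstitution Ω →
    (Transitive 𝓜 Ω →
    ∀ (A B C D : SetOfElements 𝕄) →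
    Small 𝕄 K A → Small 𝕄 K B → Small 𝕄 K C → Small 𝕄 K D →
    D ⊆ C → C ⊆ B →
    Indep 𝕄 Ω B C A → Indep 𝕄 Ω C D A → Indep 𝕄 Ω B D A)
    ×
    (Normal Ω →
    ∀ (A B C : SetOfElements 𝕄) →
    Small 𝕄 K A → Small 𝕄 K B → Small 𝕄 K C →
    Indep 𝕄 Ω A C B → Indep 𝕄 Ω (A ∪ C) C B)
proposition2p16 L T _ _ 𝓜 Ω _ Ω-closed =
  (λ Ω-trans _ _ _ _ _ _ C-small D-small D⊆C _ →
    indep-transitive 𝓜 {Ω = Ω} Ω-trans C-small D-small D⊆C) ,
  (λ Ω-normal _ _ _ _ _ _ →
    indep-normal (BigSaturatedModel.𝕄 𝓜) {Ω = Ω} Ω-closed Ω-normal)
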